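{- Let $C_n(x)$ denote the second-order Eulerian polynomials. For every $n\geqslant 1$, $C_n(x)$ equals the following lower Hessenberg determinant of order $n$: $$C_{n}(x)=\begin{vmatrix} x&-1&0&\cdots&0&0\\ C_1(x)&\binom{2}{1}x&-1&\cdots&0&0\\ C_2(x)&\binom{3}{1}C_1(x)&\binom{3}{2}x&\cdots&0&0\\ \vdots&\vdots&\vdots&\ddots&\ddots&\vdots\\ C_{n-2}(x)&\binom{n-1}{1}C_{n-3}(x)&\binom{n-1}{2}C_{n-4}(x)&\cdots&\binom{n-1}{n-2}x&-1\\ C_{n-1}(x)&\binom{n}{1}C_{n-2}(x)&\binom{n}{2}C_{n-3}(x)&\cdots&\binom{n}{n-2}C_1(x)&\binom{n}{n-1}x \end{vmatrix}_{n\times n},$$ that is, the determinant of the $n\times n$ matrix whose $(i,i)$ entry is $\binom{i}{i-1}x$ for $1\leqslant i\leqslant n$, whose $(i,j)$ entry is $\binom{i}{j-1}C_{i-j}(x)$ for $1\leqslant j<i\leqslant n$, whose $(i,i+1)$ entries are $-1$, and whose $(i,j)$ entries with $j>i+1$ are $0$.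
   Context: The second-order Eulerian polynomials $C_n(x)$ are defined by $C_0(x)=1$ and $C_n(x)=(2n-1)xC_{n-1}(x)+x(1-x)\frac{\mathrm{d}}{\mathrm{d}x}C_{n-1}(x)$ for $n\geqslant 1$; thus $C_1(x)=x$, $C_2(x)=x+2x^2$, $C_3(x)=x+8x^2+6x^3$. Equivalently, $C_n(x)=\sum_{\sigma}x^{\mathrm{des}(\sigma)}$, the sum being over all Stirling permutations $\sigma=\sigma_1\cdots\sigma_{2n}$ of the multiset $\{1,1,2,2,\ldots,n,n\}$ (arrangements in which, for each $i$, all letters between the two occurrences of $i$ are at least $i$), where $\mathrm{des}(\sigma)$ is the number of indices $i\in\{0,1,\ldots,2n\}$ with $\sigma_i>\sigma_{i+1}$, with $\sigma_0=\sigma_{2n+1}=0$. -}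

module Defs where

open import Algebra.Bundles.Raw using (RawRing)
open import Data.Bool.Base using (if_then_else_)
open import Data.Fin.Base using (Fin; zero; suc; toℕ; punchIn)
open import Data.Integer.Base as ℤ using (ℤ; +_; 0ℤ; 1ℤ)
open import Data.List.Base using (List; []; _∷_; map)
open import Data.Nat.Base as ℕ using (ℕ; zero; suc; _∸_; _≡ᵇ_; _<ᵇ_)
open import Data.Nat.Combinatorics using (_C_)
open import Level using (0ℓ)
open import Relation.Binary.PropositionalEquality using (_≡_)

-- ℤ[x]: a list a₀ ∷ a₁ ∷ … ∷ [] is the polynomial a₀ + a₁ x + ….
-- Trailing zeros are allowed, so the equality of polynomials is the
-- coefficientwise _≈_ and not _≡_.
Poly : Set
Poly = List ℤ

coeff : Poly → ℕ → ℤ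
coeff []      _       = 0ℤ
coeff (a ∷ p) zero    = a
coeff (a ∷ p) (suc k) = coeff p k

infix 4 _≈_
_≈_ : Poly → Poly → Set
p ≈ q = ∀ k → coeff p k ≡ coeff q k

infixl 6 _+_ _-_
infixl 7 _*_ _·_
infix  8 -_

_+_ : Poly → Poly → Poly
[]      + q       = q
(a ∷ p) + []      = a ∷ p
(a ∷ p) + (b ∷ q) = (a ℤ.+ b) ∷ (p + q)

_·_ : ℤ → Poly → Poly
c · p = map (c ℤ.*_) p

-_ : Poly → Poly
- p = map ℤ.-_ p

_-_ : Poly → Poly → Poly
p - q = p + (- q)

-- (a + x p) q = a q + x (p q)
_*_ : Poly → Poly → Poly
[]      * q = []
(a ∷ p) * q = a · q + (0ℤ ∷ (p * q))

𝟘 𝟙 x : Poly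
𝟘 = []
𝟙 = 1ℤ ∷ []
x = 0ℤ ∷ 1ℤ ∷ []

-- derivativeFrom k (b₀ ∷ b₁ ∷ …) = k b₀ ∷ (k + 1) b₁ ∷ …
derivativeFrom : ℕ → Poly → Poly
derivativeFrom k []      = []
derivativeFrom k (b ∷ p) = (+ k ℤ.* b) ∷ derivativeFrom (suc k) p

d/dx : Poly → Poly
d/dx []      = []
d/dx (_ ∷ p) = derivativeFrom 1 p

polyRawRing : RawRing 0ℓ 0ℓ
polyRawRing = record
  { Carrier = Poly
  ; _≈_     = _≈_
  ; _+_     = _+_
  ; _*_     = _*_
  ; -_      = -_
  ; 0#      = 𝟘
  ; 1#      = 𝟙
  }

secondOrderEulerian : ℕ → Poly
secondOrderEulerian zero    = 𝟙
secondOrderEulerian (suc m) =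
    + (2 ℕ.* suc m ∸ 1) · (x * secondOrderEulerian m)
  + x * (𝟙 - x) * d/dx (secondOrderEulerian m)

module Determinant {c ℓ} (R : RawRing c ℓ) where
  open RawRing R using (Carrier; 1#; rawSemiring)
    renaming (_*_ to _*ᴿ_; -_ to -ᴿ_)
  open import Algebra.Definitions.RawSemiring rawSemiring using (sum; _^_)

  -- Laplace expansion along the first row; punchIn j skips column j.
  det : ∀ n → (Fin n → Fin n → Carrier) → Carrier
  det zero    M = 1#
  det (suc n) M = sum λ j →
    ((-ᴿ 1#) ^ toℕ j) *ᴿ
    (M zero j *ᴿ det n (λ r s → M (suc r) (punchIn j s)))

open Determinant polyRawRing public using (det)

-- The (i , j) entry, with i and j counted from 1.  On the diagonal
-- the factor is x, although secondOrderEulerian 0 is 1.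
entry : ℕ → ℕ → Poly
entry i j =
  if i ≡ᵇ j then + (i C (i ∸ 1)) · x
  else if j <ᵇ i then + (i C (j ∸ 1)) · secondOrderEulerian (i ∸ j)
  else if j ≡ᵇ suc i then - 𝟙
  else 𝟘

eulerianHessenberg : ∀ n → Fin n → Fin n → Poly
eulerianHessenberg n i j = entry (suc (toℕ i)) (suc (toℕ j))

{-# OPTIONS --safe #-}

-- Let A be the exponential generating function (in t) of the polynomials Cₙ
-- and let G = ∫ (A − 1 + x) dt. The derivation
-- D = d/dt − 2 x t d/dt − x (1 − x) d/dx satisfies D A = x A, by the recurrence
-- of the Cₙ, and hence D G = x − x G. So D (A G) = x A = D (A − 1), and since D
-- determines a series from its constant term, A G = A − 1, that is,
--   Cₙ = n x Cₙ₋₁ + Σ_{k < n-1} binom(n, k) C_k Cₙ₋₁₋ₖ.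
-- This is the recurrence of the leading principal minors of the Hessenberg
-- matrix. As the determinant is expanded along the first row, the minors are
-- obtained by folding that row into the first column.
module Submission where

open import Algebra.Bundles using (CommutativeRing)
open import Algebra.Bundles.Raw using (RawRing)
import Algebra.Properties.Monoid.Sum as MonoidSum
import Algebra.Properties.Ring as RingProperties
import Algebra.Properties.Semiring.Mult as SemiringMult
import Algebra.Solver.Ring.NaturalCoefficients.Default as NaturalCoefficients
open import Data.Fin.Base as Fin using (Fin; toℕ; punchIn)
open import Data.Integer.Base as ℤ using (ℤ; +_; 0ℤ)
import Data.Integer.Properties as ℤ
open import Data.Integer.Solver using (module +-*-Solver)
open import Data.List.Base using ([]; _∷_)
open import Data.Nat.Base as ℕ using (ℕ; zero; suc; _∸_; _≤_; _<_; _≥_; z≤n; s≤s)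
open import Data.Nat.Combinatorics using (_C_; nCk+nC[k+1]≡[n+1]C[k+1]; nCn≡1; k>n⇒nCk≡0)
import Data.Nat.Properties as ℕ
open import Data.Product.Base using (_,_)
open import Data.Sum.Base using (_⊎_; inj₁; inj₂)
open import Level using (0ℓ)
open import Relation.Binary.PropositionalEquality as ≡ using (_≡_; _≗_)
open import Relation.Nullary.Decidable using (dec-true; dec-false)
open import Defs using (module Determinant)

-- Finite sums and binomial convolution of sequences.

module Sequences {c ℓ} (R : CommutativeRing c ℓ) where
  open CommutativeRing R hiding (zero)
  open SemiringMult semiring using (_×_; ×-congʳ; ×-congˡ; ×-homo-+)
  open NaturalCoefficients commutativeSemiring using (solve; _:=_; _:+_; _:*_)
  open import Relation.Binary.Reasoning.Setoid setoid

  ∑ : ℕ → (ℕ → Carrier) → Carrier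
  ∑ zero    f = 0#
  ∑ (suc n) f = f 0 + ∑ n (λ k → f (suc k))

  ∑-cong : ∀ n {f g : ℕ → Carrier} → (∀ k → k < n → f k ≈ g k) → ∑ n f ≈ ∑ n g
  ∑-cong zero    f≈g = refl
  ∑-cong (suc n) f≈g =
    +-cong (f≈g 0 (s≤s z≤n)) (∑-cong n λ k k<n → f≈g (suc k) (s≤s k<n))

  ∑-+ : ∀ n f g → ∑ n (λ k → f k + g k) ≈ ∑ n f + ∑ n g
  ∑-+ zero    f g = sym (+-identityˡ 0#)
  ∑-+ (suc n) f g = begin
    f 0 + g 0 + ∑ n (λ k → f (suc k) + g (suc k))                ≈⟨ +-congˡ (∑-+ n _ _) ⟩
    f 0 + g 0 + (∑ n (λ k → f (suc k)) + ∑ n (λ k → g (suc k)))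
      ≈⟨ solve 4 (λ a b c d → a :+ b :+ (c :+ d) := a :+ c :+ (b :+ d)) refl _ _ _ _ ⟩
    ∑ (suc n) f + ∑ (suc n) g                                    ∎

  ∑-last : ∀ n f → ∑ (suc n) f ≈ ∑ n f + f n
  ∑-last zero    f = +-comm (f 0) 0#
  ∑-last (suc n) f = trans (+-congˡ (∑-last n _)) (sym (+-assoc _ _ _))

  -- The sequence of Taylor coefficients (those of tⁿ/n!) of a product of two
  -- exponential generating functions, computed by the product rule for d/dt.
  infixl 7 _⋆_
  _⋆_ : (ℕ → Carrier) → (ℕ → Carrier) → ℕ → Carrier
  (a ⋆ b) zero    = a 0 * b 0
  (a ⋆ b) (suc n) = ((λ k → a (suc k)) ⋆ b) n + (a ⋆ (λ k → b (suc k))) n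

  ⋆-cong : ∀ {a a′ b b′} → (∀ n → a n ≈ a′ n) → (∀ n → b n ≈ b′ n) →
           ∀ n → (a ⋆ b) n ≈ (a′ ⋆ b′) n
  ⋆-cong p q zero    = *-cong (p 0) (q 0)
  ⋆-cong p q (suc n) =
    +-cong (⋆-cong (λ k → p (suc k)) q n) (⋆-cong p (λ k → q (suc k)) n)

  ⋆-distribʳ : ∀ a a′ b n → ((λ k → a k + a′ k) ⋆ b) n ≈ (a ⋆ b) n + (a′ ⋆ b) n
  ⋆-distribʳ a a′ b zero    = distribʳ _ _ _
  ⋆-distribʳ a a′ b (suc n) = trans
    (+-cong (⋆-distribʳ _ _ _ n) (⋆-distribʳ _ _ _ n))
    (solve 4 (λ a b c d → a :+ b :+ (c :+ d) := a :+ c :+ (b :+ d)) refl _ _ _ _)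

  ⋆-distribˡ : ∀ a b b′ n → (a ⋆ (λ k → b k + b′ k)) n ≈ (a ⋆ b) n + (a ⋆ b′) n
  ⋆-distribˡ a b b′ zero    = distribˡ _ _ _
  ⋆-distribˡ a b b′ (suc n) = trans
    (+-cong (⋆-distribˡ _ _ _ n) (⋆-distribˡ _ _ _ n))
    (solve 4 (λ a b c d → a :+ b :+ (c :+ d) := a :+ c :+ (b :+ d)) refl _ _ _ _)

  ⋆-scaleˡ : ∀ y a b n → ((λ k → y * a k) ⋆ b) n ≈ y * (a ⋆ b) n
  ⋆-scaleˡ y a b zero    = *-assoc _ _ _
  ⋆-scaleˡ y a b (suc n) =
    trans (+-cong (⋆-scaleˡ _ _ _ n) (⋆-scaleˡ _ _ _ n)) (sym (distribˡ _ _ _))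

  ⋆-scaleʳ : ∀ y a b n → (a ⋆ (λ k → y * b k)) n ≈ y * (a ⋆ b) n
  ⋆-scaleʳ y a b zero    = solve 3 (λ y a b → a :* (y :* b) := y :* (a :* b)) refl _ _ _
  ⋆-scaleʳ y a b (suc n) =
    trans (+-cong (⋆-scaleʳ _ _ _ n) (⋆-scaleʳ _ _ _ n)) (sym (distribˡ _ _ _))

  ⋆-zeroʳ : ∀ a {b} → (∀ n → b n ≈ 0#) → ∀ n → (a ⋆ b) n ≈ 0#
  ⋆-zeroʳ a b≈0 zero    = trans (*-congˡ (b≈0 0)) (zeroʳ _)
  ⋆-zeroʳ a b≈0 (suc n) = trans
    (+-cong (⋆-zeroʳ _ b≈0 n) (⋆-zeroʳ a (λ k → b≈0 (suc k)) n))
    (+-identityˡ 0#)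

  -- A factor that is constant in t passes through d/dt: every term in which a derivative falls on
  -- `b` vanishes.
  ⋆-constʳ : ∀ a {b} → (∀ n → b (suc n) ≈ 0#) → ∀ n → (a ⋆ b) n ≈ a n * b 0
  ⋆-constʳ a b≈0 zero    = refl
  ⋆-constʳ a b≈0 (suc n) =
    trans (+-cong (⋆-constʳ _ b≈0 n) (⋆-zeroʳ a b≈0 n)) (+-identityʳ _)

  -- Pascal's rule merges the two halves of the product rule. This closed form is what brings the
  -- binomial coefficients of the matrix into play.
  ⋆-binomial : ∀ a b n → (a ⋆ b) n ≈ ∑ (suc n) (λ k → (n C k) × (a k * b (n ∸ k)))
  ⋆-binomial a b zero    = sym (trans (+-identityʳ _) (+-identityʳ _))
  ⋆-binomial a b (suc n) = begin
    ((λ k → a (suc k)) ⋆ b) n + (a ⋆ (λ k → b (suc k))) n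
      ≈⟨ +-cong (⋆-binomial _ b n) (⋆-binomial a _ n) ⟩
    ∑ (suc n) w + ∑ (suc n) (λ k → (n C k) × (a k * b (suc (n ∸ k))))
      ≈⟨ +-congˡ (begin
        ∑ (suc n) (λ k → (n C k) × (a k * b (suc (n ∸ k))))
          ≈⟨ ∑-cong (suc n) (λ { k (s≤s k≤n) → ×-congʳ (n C k)
               (*-congˡ {x = a k} (reflexive (≡.cong b (≡.sym (ℕ.+-∸-assoc 1 k≤n))))) }) ⟩
        ∑ (suc n) u
          -- The vanishing term with `n C suc n` is appended, so that the sum can lose its term at 0
          -- and still pair off with `w`.
          ≈⟨ +-identityʳ _ ⟨
        ∑ (suc n) u + 0#
          ≈⟨ +-congˡ (×-congˡ (k>n⇒nCk≡0 (ℕ.n<1+n n))) ⟨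
        ∑ (suc n) u + u (suc n)
          ≈⟨ ∑-last (suc n) u ⟨
        u 0 + ∑ (suc n) (λ k → u (suc k)) ∎) ⟩
    ∑ (suc n) w + (u 0 + ∑ (suc n) (λ k → u (suc k)))
      ≈⟨ solve 3 (λ p q r → p :+ (q :+ r) := q :+ (p :+ r)) refl _ _ _ ⟩
    u 0 + (∑ (suc n) w + ∑ (suc n) (λ k → u (suc k)))
      ≈⟨ +-congˡ (∑-+ (suc n) w (λ k → u (suc k))) ⟨
    u 0 + ∑ (suc n) (λ k → w k + u (suc k))
      ≈⟨ +-congˡ (∑-cong (suc n) λ k _ → trans
           (sym (×-homo-+ (a (suc k) * b (n ∸ k)) (n C k) (n C suc k)))
           (×-congˡ (nCk+nC[k+1]≡[n+1]C[k+1] n k))) ⟩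
    u 0 + ∑ (suc n) (λ k → (suc n C suc k) × (a (suc k) * b (n ∸ k)))
      ∎
    where
    u w : ℕ → Carrier
    u k = (n C k) × (a k * b (suc n ∸ k))
    w k = (n C k) × (a (suc k) * b (n ∸ k))

-- Determinants of lower Hessenberg matrices with superdiagonal -1.

module HessenbergDeterminant {c ℓ} (R : CommutativeRing c ℓ) where
  open CommutativeRing R hiding (zero)
  open Determinant rawRing using (det)
  open Sequences R using (∑; ∑-cong)
  open import Algebra.Definitions.RawSemiring (RawRing.rawSemiring rawRing) using (_^_)
  open MonoidSum +-monoid using (sum; sum-cong-≋; sum-replicate-zero)
  open RingProperties ring using (-1*x≈-x; -‿involutive)
  open NaturalCoefficients commutativeSemiring using (solve; _:=_; _:+_; _:*_; con)
  open import Relation.Binary.Reasoning.Setoid setoid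

  det-cong : ∀ n (M N : Fin n → Fin n → Carrier) → (∀ i j → M i j ≈ N i j) → det n M ≈ det n N
  det-cong zero    M N M≈N = refl
  det-cong (suc n) M N M≈N = sum-cong-≋ {suc n} λ j →
    *-congˡ {(- 1#) ^ toℕ j} (*-cong (M≈N Fin.zero j)
      (det-cong n _ _ λ r s → M≈N (Fin.suc r) (punchIn j s)))

  sum-zero : ∀ n {f : Fin n → Carrier} → (∀ i → f i ≈ 0#) → sum f ≈ 0#
  sum-zero n f≈0 = trans (sum-cong-≋ {n} f≈0) (sum-replicate-zero n)

  infixr 5 _◂_
  -- The first column is kept apart because the reductions below alter it alone; the other columns
  -- are only shifted.
  _◂_ : (ℕ → Carrier) → (ℕ → ℕ → Carrier) → ℕ → ℕ → Carrier
  (v ◂ h) i zero    = v i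
  (v ◂ h) i (suc j) = h i j

  detℕ : ∀ n → (ℕ → ℕ → Carrier) → Carrier
  detℕ n M = det n λ i j → M (toℕ i) (toℕ j)

  shift : (ℕ → ℕ → Carrier) → ℕ → ℕ → Carrier
  shift h i j = h (suc i) (suc j)

  -- h holds the columns after the first, so its diagonal is the superdiagonal
  -- of v ◂ h.
  record IsHessenberg (h : ℕ → ℕ → Carrier) : Set ℓ where
    field
      diag  : ∀ i → h i i ≈ - 1#
      above : ∀ i j → i < j → h i j ≈ 0#

  open IsHessenberg

  shift-hessenberg : ∀ {h} → IsHessenberg h → IsHessenberg (shift h)
  shift-hessenberg H .diag i        = H .diag (suc i)
  shift-hessenberg H .above i j i<j = H .above (suc i) (suc j) (s≤s i<j)

  det₁ : ∀ v h → detℕ 1 (v ◂ h) ≈ v 0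
  det₁ v h = solve 1 (λ v → con 1 :* (v :* con 1) :+ con 0 := v) refl (v 0)

  -- Only the first two entries of the first row survive. The second is -1 and carries the sign -1,
  -- so its minor enters with coefficient 1. That minor keeps the first column without its top
  -- entry, while the other minor begins with the second column.
  det-expand : ∀ n v {h} → IsHessenberg h →
    detℕ (suc (suc n)) (v ◂ h) ≈
      v 0 * detℕ (suc n) ((λ i → h (suc i) 0) ◂ shift h) +
      detℕ (suc n) ((λ i → v (suc i)) ◂ shift h)
  det-expand n v {h} H = begin
    1# * (v 0 * D₀) + (- 1# * 1# * (h 0 0 * D₁) + sum rest)
      ≈⟨ +-cong (trans (*-identityˡ _) (*-congˡ D₀≈))
                (trans (+-cong second (sum-zero n rest≈0)) (+-identityʳ _)) ⟩
    v 0 * detℕ (suc n) ((λ i → h (suc i) 0) ◂ shift h) +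
      detℕ (suc n) ((λ i → v (suc i)) ◂ shift h) ∎
    where
    M : Fin (suc (suc n)) → Fin (suc (suc n)) → Carrier
    M i j = (v ◂ h) (toℕ i) (toℕ j)
    minor : Fin (suc (suc n)) → Fin (suc n) → Fin (suc n) → Carrier
    minor j r s = M (Fin.suc r) (punchIn j s)
    smaller : (ℕ → Carrier) → Fin (suc n) → Fin (suc n) → Carrier
    smaller u r s = (u ◂ shift h) (toℕ r) (toℕ s)
    D₀ D₁ : Carrier
    D₀ = det (suc n) (minor Fin.zero)
    D₁ = det (suc n) (minor (Fin.suc Fin.zero))
    D₀≈ : D₀ ≈ detℕ (suc n) ((λ i → h (suc i) 0) ◂ shift h)
    D₀≈ = det-cong (suc n) (minor Fin.zero) (smaller λ i → h (suc i) 0)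
      λ { r Fin.zero → refl ; r (Fin.suc s) → refl }
    D₁≈ : D₁ ≈ detℕ (suc n) ((λ i → v (suc i)) ◂ shift h)
    D₁≈ = det-cong (suc n) (minor (Fin.suc Fin.zero)) (smaller λ i → v (suc i))
      λ { r Fin.zero → refl ; r (Fin.suc s) → refl }
    second : - 1# * 1# * (h 0 0 * D₁) ≈ detℕ (suc n) ((λ i → v (suc i)) ◂ shift h)
    second = begin
      - 1# * 1# * (h 0 0 * D₁)   ≈⟨ *-cong (*-identityʳ _) (*-congʳ (H .diag 0)) ⟩
      - 1# * (- 1# * D₁)         ≈⟨ trans (*-congˡ (-1*x≈-x D₁)) (-1*x≈-x _) ⟩
      - - D₁                     ≈⟨ -‿involutive D₁ ⟩
      D₁                         ≈⟨ D₁≈ ⟩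
      detℕ (suc n) ((λ i → v (suc i)) ◂ shift h) ∎
    rest : Fin n → Carrier
    rest j = (- 1#) ^ suc (suc (toℕ j)) * (h 0 (suc (toℕ j)) * det (suc n) (minor (Fin.suc (Fin.suc j))))
    rest≈0 : ∀ j → rest j ≈ 0#
    rest≈0 j = trans (*-congˡ (trans (*-congʳ (H .above 0 _ (s≤s z≤n))) (zeroˡ _))) (zeroʳ _)

  -- For Hessenberg matrices linearity in the first column follows from `det-expand` by induction:
  -- one minor does not involve that column, and the other is again of the same shape.
  det-linear : ∀ n y u v {h} → IsHessenberg h →
    detℕ (suc n) ((λ i → y * u i + v i) ◂ h) ≈
      y * detℕ (suc n) (u ◂ h) + detℕ (suc n) (v ◂ h)
  det-linear zero y u v {h} H =
    trans (det₁ (λ i → y * u i + v i) h) (sym (+-cong (*-congˡ (det₁ u h)) (det₁ v h)))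
  det-linear (suc n) y u v {h} H = begin
    detℕ (suc (suc n)) ((λ i → y * u i + v i) ◂ h)
      ≈⟨ trans (det-expand n _ H) (+-congˡ (det-linear n y _ _ (shift-hessenberg H))) ⟩
    (y * u 0 + v 0) * d + (y * p + q)
      ≈⟨ solve 6 (λ y u v d p q → (y :* u :+ v) :* d :+ (y :* p :+ q)
           := y :* (u :* d :+ p) :+ (v :* d :+ q)) refl y (u 0) (v 0) d p q ⟩
    y * (u 0 * d + p) + (v 0 * d + q)
      ≈⟨ +-cong (*-congˡ (det-expand n u H)) (det-expand n v H) ⟨
    y * detℕ (suc (suc n)) (u ◂ h) + detℕ (suc (suc n)) (v ◂ h) ∎
    where
    d p q : Carrier
    d = detℕ (suc n) ((λ i → h (suc i) 0) ◂ shift h)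
    p = detℕ (suc n) ((λ i → u (suc i)) ◂ shift h)
    q = detℕ (suc n) ((λ i → v (suc i)) ◂ shift h)

  -- Adding v 0 times the second column to the first clears the top left entry
  -- and leaves a Hessenberg matrix of smaller order for the shifted sequence.
  det-hessenberg : ∀ n v {h} (E : ℕ → Carrier) → IsHessenberg h →
    (∀ m → E m ≈ v m + ∑ m (λ j → E j * h m j)) →
    detℕ (suc n) (v ◂ h) ≈ E n
  det-hessenberg zero v {h} E H E-rec =
    trans (det₁ v h) (sym (trans (E-rec 0) (+-identityʳ _)))
  det-hessenberg (suc n) v {h} E H E-rec = begin
    detℕ (suc (suc n)) (v ◂ h)
      ≈⟨ det-expand n v H ⟩
    v 0 * detℕ (suc n) ((λ i → h (suc i) 0) ◂ shift h)
      + detℕ (suc n) ((λ i → v (suc i)) ◂ shift h)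
      -- The two minors differ only in their first columns, so linearity read backwards fuses them;
      -- this performs the column operation.
      ≈⟨ det-linear n (v 0) _ _ (shift-hessenberg H) ⟨
    detℕ (suc n) ((λ i → v 0 * h (suc i) 0 + v (suc i)) ◂ shift h)
      ≈⟨ det-hessenberg n _ (λ m → E (suc m)) (shift-hessenberg H) shifted-rec ⟩
    E (suc n) ∎
    where
    shifted-rec : ∀ m → E (suc m) ≈
      v 0 * h (suc m) 0 + v (suc m) + ∑ m (λ j → E (suc j) * shift h m j)
    shifted-rec m = begin
      E (suc m)
        ≈⟨ E-rec (suc m) ⟩
      v (suc m) + (E 0 * h (suc m) 0 + ∑ m (λ j → E (suc j) * shift h m j))
        -- The recurrence at 0 has an empty sum, so `E 0` is the multiplier `v 0` of the column
        -- operation.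
        ≈⟨ +-congˡ (+-congʳ (*-congʳ (trans (E-rec 0) (+-identityʳ _)))) ⟩
      v (suc m) + (v 0 * h (suc m) 0 + ∑ m (λ j → E (suc j) * shift h m j))
        ≈⟨ solve 3 (λ p q r → p :+ (q :+ r) := q :+ p :+ r) refl _ _ _ ⟩
      v 0 * h (suc m) 0 + v (suc m) + ∑ m (λ j → E (suc j) * shift h m j) ∎

-- The convolution identity for sequences with the Eulerian recurrence.

module EulerianConvolution {c ℓ} (R : CommutativeRing c ℓ) where
  open CommutativeRing R hiding (zero)
  open Sequences R
  open HessenbergDeterminant R
  open SemiringMult semiring using (_×_; ×-congʳ; ×-congˡ; ×-homo-1; ×-assoc-*; ×-comm-*; ×-assocˡ)
  open RingProperties ring using (x+x≈x⇒x≈0; +-cancelʳ)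
  open NaturalCoefficients commutativeSemiring using (solve; _:=_; _:+_; _:*_; con)
  open import Relation.Binary.Reasoning.Setoid setoid

  -- `y` stands for 1 - x. The derivation laws are asked of `x * d`, since for polynomials x d/dx
  -- acts on coefficients as a mere weight. The hypothesis `xyd-x` is what ties `y` to 1 - x and
  -- `d x` to 1.
  module Derivation
    (x y : Carrier)
    (d : Carrier → Carrier)
    (xd-cong : ∀ p q → p ≈ q → x * d p ≈ x * d q)
    (xd-+ : ∀ p q → x * d (p + q) ≈ x * d p + x * d q)
    (xd-* : ∀ p q → x * d (p * q) ≈ x * d p * q + p * (x * d q))
    (xyd-x : x * y * d x + x * x ≈ x)
    where

    Θ : Carrier → Carrier
    Θ p = x * y * d p

    Θ≈ : ∀ p → Θ p ≈ y * (x * d p)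
    Θ≈ p = solve 3 (λ x y d → x :* y :* d := y :* (x :* d)) refl x y (d p)

    Θ-cong : ∀ {p q} → p ≈ q → Θ p ≈ Θ q
    Θ-cong p≈q = trans (Θ≈ _) (trans (*-congˡ (xd-cong _ _ p≈q)) (sym (Θ≈ _)))

    Θ-+ : ∀ p q → Θ (p + q) ≈ Θ p + Θ q
    Θ-+ p q = begin
      Θ (p + q)                         ≈⟨ Θ≈ (p + q) ⟩
      y * (x * d (p + q))               ≈⟨ *-congˡ (xd-+ p q) ⟩
      y * (x * d p + x * d q)
        ≈⟨ solve 4 (λ x y d e → y :* (x :* d :+ x :* e) := x :* y :* d :+ x :* y :* e) refl x y (d p) (d q) ⟩
      Θ p + Θ q                         ∎

    Θ-* : ∀ p q → Θ (p * q) ≈ Θ p * q + p * Θ q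
    Θ-* p q = begin
      Θ (p * q)                            ≈⟨ Θ≈ (p * q) ⟩
      y * (x * d (p * q))                  ≈⟨ *-congˡ (xd-* p q) ⟩
      y * (x * d p * q + p * (x * d q))
        ≈⟨ solve 6 (λ x y p q d e → y :* (x :* d :* q :+ p :* (x :* e))
             := x :* y :* d :* q :+ p :* (x :* y :* e)) refl x y p q (d p) (d q) ⟩
      Θ p * q + p * Θ q                    ∎

    Θ-0 : Θ 0# ≈ 0#
    Θ-0 = x+x≈x⇒x≈0 _ (trans (sym (Θ-+ 0# 0#)) (Θ-cong (+-identityˡ 0#)))

    Θ-1 : Θ 1# ≈ 0#
    Θ-1 = x+x≈x⇒x≈0 _ (begin
      Θ 1# + Θ 1#           ≈⟨ +-cong (*-identityʳ _) (*-identityˡ _) ⟨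
      Θ 1# * 1# + 1# * Θ 1# ≈⟨ Θ-* 1# 1# ⟨
      Θ (1# * 1#)           ≈⟨ Θ-cong (*-identityˡ 1#) ⟩
      Θ 1#                  ∎)

    -- On exponential generating functions in t this is z t d/dt + Θ.
    Δ : Carrier → (ℕ → Carrier) → ℕ → Carrier
    Δ z a n = (n × z) * a n + Θ (a n)

    Δ-cong : ∀ z n {p q} → p ≈ q → (n × z) * p + Θ p ≈ (n × z) * q + Θ q
    Δ-cong z n eq = +-cong (*-congˡ eq) (Θ-cong eq)

    -- The index shift is d/dt, and the extra term is its commutator with z t d/dt, namely z d/dt.
    Δ-suc : ∀ z a n → Δ z a (suc n) ≈ Δ z (λ k → a (suc k)) n + z * a (suc n)
    Δ-suc z a n = solve 4
      (λ z w p q → (z :+ w) :* p :+ q := w :* p :+ q :+ z :* p) refl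
      z (n × z) (a (suc n)) (Θ (a (suc n)))

    -- Both t d/dt and `Θ` are derivations, hence so is `Δ z`. The induction follows the recursion
    -- of `⋆`, which is itself the product rule for d/dt.
    Δ-⋆ : ∀ z a b n → Δ z (a ⋆ b) n ≈ (Δ z a ⋆ b) n + (a ⋆ Δ z b) n
    Δ-⋆ z a b zero = trans (+-congˡ (Θ-* (a 0) (b 0)))
      (solve 4 (λ p q p′ q′ → con 0 :* (p :* q) :+ (p′ :* q :+ p :* q′)
                   := (con 0 :* p :+ p′) :* q :+ p :* (con 0 :* q :+ q′)) refl
        (a 0) (b 0) (Θ (a 0)) (Θ (b 0)))
    Δ-⋆ z a b (suc n) = begin
      (z + n × z) * (P + Q) + Θ (P + Q)
        ≈⟨ +-congˡ (Θ-+ P Q) ⟩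
      (z + n × z) * (P + Q) + (Θ P + Θ Q)
        -- The weight n + 1 splits into n, for the induction hypotheses, and one further `z` on each
        -- half, which `left` and `right` absorb as commutator terms.
        ≈⟨ solve 6 (λ z w P Q P′ Q′ → (z :+ w) :* (P :+ Q) :+ (P′ :+ Q′)
             := w :* P :+ P′ :+ (w :* Q :+ Q′) :+ (z :* P :+ z :* Q)) refl
             z (n × z) P Q (Θ P) (Θ Q) ⟩
      Δ z (Sa ⋆ b) n + Δ z (a ⋆ Sb) n + (z * P + z * Q)
        ≈⟨ +-congʳ (+-cong (Δ-⋆ z Sa b n) (Δ-⋆ z a Sb n)) ⟩
      (Δ z Sa ⋆ b) n + (Sa ⋆ Δ z b) n + ((Δ z a ⋆ Sb) n + (a ⋆ Δ z Sb) n) + (z * P + z * Q)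
        ≈⟨ solve 6 (λ s t u v p q → s :+ t :+ (u :+ v) :+ (p :+ q)
             := s :+ p :+ u :+ (t :+ (v :+ q))) refl _ _ _ _ _ _ ⟩
      (Δ z Sa ⋆ b) n + z * P + (Δ z a ⋆ Sb) n + ((Sa ⋆ Δ z b) n + ((a ⋆ Δ z Sb) n + z * Q))
        ≈⟨ +-cong (+-congʳ (left n)) (+-congˡ (right n)) ⟨
      (Δ z a ⋆ b) (suc n) + (a ⋆ Δ z b) (suc n)
        ∎
      where
      Sa Sb : ℕ → Carrier
      Sa k = a (suc k)
      Sb k = b (suc k)
      P Q : Carrier
      P = (Sa ⋆ b) n
      Q = (a ⋆ Sb) n
      left : ∀ n → ((λ k → Δ z a (suc k)) ⋆ b) n ≈ (Δ z Sa ⋆ b) n + z * (Sa ⋆ b) n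
      left n = trans (⋆-cong (Δ-suc z a) (λ _ → refl) n)
        (trans (⋆-distribʳ _ _ b n) (+-congˡ (⋆-scaleˡ z Sa b n)))
      right : ∀ n → (a ⋆ (λ k → Δ z b (suc k))) n ≈ (a ⋆ Δ z Sb) n + z * (a ⋆ Sb) n
      right n = trans (⋆-cong (λ _ → refl) (Δ-suc z b) n)
        (trans (⋆-distribˡ a _ _ n) (+-congˡ (⋆-scaleʳ z a Sb n)))

    -- The Taylor coefficients of ∫ (A − 1 + x) dt, where A, with A(0) = 1, is the
    -- exponential generating function of a.
    ∫ : (ℕ → Carrier) → ℕ → Carrier
    ∫ a zero          = 0#
    ∫ a (suc zero)    = x
    ∫ a (suc (suc n)) = a (suc n)

    module _ (a : ℕ → Carrier)
      (a-zero : a 0 ≈ 1#)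
      (a-rec : ∀ n → a (suc n) ≈ suc (n ℕ.* 2) × (x * a n) + Θ (a n))
      where

      b : ℕ → Carrier
      b = ∫ a

      -- This is D A = x A, with D the index shift minus `Δ (x + x)`: the factor 2n + 1 splits into
      -- 2n, the weight of 2 t d/dt, and 1.
      a-suc : ∀ n → a (suc n) ≈ Δ (x + x) a n + x * a n
      a-suc n = begin
        a (suc n)                                        ≈⟨ a-rec n ⟩
        x * a n + (n ℕ.* 2) × (x * a n) + Θ (a n)        ≈⟨ +-congʳ (+-congˡ (×-assocˡ (x * a n) n 2)) ⟨
        x * a n + n × (2 × (x * a n)) + Θ (a n)
          ≈⟨ +-congʳ (+-congˡ (×-congʳ n
               (solve 2 (λ x p → x :* p :+ (x :* p :+ con 0) := (x :+ x) :* p) refl x (a n)))) ⟩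
        x * a n + n × ((x + x) * a n) + Θ (a n)          ≈⟨ +-congʳ (+-congˡ (×-assoc-* n (x + x) (a n))) ⟨
        x * a n + (n × (x + x)) * a n + Θ (a n)
          ≈⟨ solve 3 (λ p q r → p :+ q :+ r := q :+ r :+ p) refl _ _ _ ⟩
        Δ (x + x) a n + x * a n                          ∎

      -- The coefficients of the series x, constant in t.
      δ : ℕ → Carrier
      δ zero    = x
      δ (suc _) = 0#

      a-one : a 1 ≈ x
      a-one = begin
        a 1                               ≈⟨ a-suc 0 ⟩
        0# * a 0 + Θ (a 0) + x * a 0
          ≈⟨ +-cong (+-cong (zeroˡ _) (trans (Θ-cong a-zero) Θ-1)) (*-congˡ a-zero) ⟩
        0# + 0# + x * 1#                  ≈⟨ solve 1 (λ x → con 0 :+ con 0 :+ x :* con 1 := x) refl x ⟩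
        x                                 ∎

      -- This is D G = x - x G with x G moved to the left. The cases follow those of `∫`: index 0
      -- yields the constant x, index 1 is special because `b 1` is x and not `a 0`, and the rest is
      -- `a-suc`.
      b-rec : ∀ n → b (suc n) + x * b n ≈ Δ (x + x) b n + δ n
      b-rec zero = begin
        x + x * 0#                   ≈⟨ solve 1 (λ x → x :+ x :* con 0 := con 0 :* con 0 :+ con 0 :+ x) refl x ⟩
        0# * 0# + 0# + x             ≈⟨ +-congʳ (+-congˡ Θ-0) ⟨
        Δ (x + x) b 0 + x            ∎
      b-rec (suc zero) = begin
        a 1 + x * x                  ≈⟨ +-congʳ a-one ⟩
        x + x * x                    ≈⟨ +-congʳ xyd-x ⟨
        Θ x + x * x + x * x
          ≈⟨ solve 2 (λ x z → z :+ x :* x :+ x :* x := (x :+ x :+ con 0) :* x :+ z :+ con 0) refl x (Θ x) ⟩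
        Δ (x + x) b 1 + 0#           ∎
      b-rec (suc (suc n)) = begin
        a (suc (suc n)) + x * a (suc n)
          ≈⟨ +-congʳ (a-suc (suc n)) ⟩
        Δ (x + x) a (suc n) + x * a (suc n) + x * a (suc n)
          -- The two copies of `x * a (suc n)` raise the weight from n + 1 to n + 2, which is the
          -- index shift between `a` and `b`.
          ≈⟨ solve 4 (λ x z p q → z :* p :+ q :+ x :* p :+ x :* p
               := (x :+ x :+ z) :* p :+ q :+ con 0) refl x _ _ _ ⟩
        Δ (x + x) b (suc (suc n)) + 0# ∎

      -- D (A G) = (D A) G + A (D G) = x A G + A (x - x G) = x A. The term x A G is added to both
      -- sides and cancelled at the end, because `b-rec` carries x G on its left.
      ⋆-rec : ∀ n → (a ⋆ b) (suc n) ≈ Δ (x + x) (a ⋆ b) n + x * a n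
      ⋆-rec n = +-cancelʳ (x * (a ⋆ b) n) _ _ (begin
        A n + B n + x * (a ⋆ b) n
          ≈⟨ trans (+-assoc _ _ _) (+-congˡ (+-congˡ (sym (⋆-scaleʳ x a b n)))) ⟩
        A n + (B n + (a ⋆ (λ k → x * b k)) n)
          ≈⟨ +-cong (⋆-cong a-suc (λ _ → refl) n) (sym (⋆-distribˡ a _ _ n)) ⟩
        ((λ k → Δ z a k + x * a k) ⋆ b) n + (a ⋆ (λ k → b (suc k) + x * b k)) n
          ≈⟨ +-cong (trans (⋆-distribʳ _ _ b n) (+-congˡ (⋆-scaleˡ x a b n)))
                    (trans (⋆-cong (λ _ → refl) b-rec n) (⋆-distribˡ a _ _ n)) ⟩
        (Δ z a ⋆ b) n + x * (a ⋆ b) n + ((a ⋆ Δ z b) n + (a ⋆ δ) n)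
          ≈⟨ +-congˡ (+-congˡ (⋆-constʳ a (λ _ → refl) n)) ⟩
        (Δ z a ⋆ b) n + x * (a ⋆ b) n + ((a ⋆ Δ z b) n + a n * x)
          ≈⟨ solve 5 (λ p q r s x → p :+ q :+ (r :+ s :* x) := p :+ r :+ x :* s :+ q) refl _ _ _ _ _ ⟩
        (Δ z a ⋆ b) n + (a ⋆ Δ z b) n + x * a n + x * (a ⋆ b) n
          ≈⟨ +-congʳ (+-congʳ (Δ-⋆ z a b n)) ⟨
        Δ z (a ⋆ b) n + x * a n + x * (a ⋆ b) n ∎)
        where
        z : Carrier
        z = x + x
        A B : ℕ → Carrier
        A = (λ k → a (suc k)) ⋆ b
        B = a ⋆ (λ k → b (suc k))

      -- By `⋆-rec` and `a-suc`, A G and A obey the same recursion with source `x * a n`. Their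
      -- terms at index 0 are 0 and 1, but `Δ` sends both to 0, so the sequences agree from index 1
      -- on.
      ⋆-fixed : ∀ n → (a ⋆ b) (suc n) ≈ a (suc n)
      ⋆-fixed zero = begin
        (a ⋆ b) 1                             ≈⟨ ⋆-rec 0 ⟩
        0# * (a 0 * b 0) + Θ (a 0 * b 0) + x * a 0
          ≈⟨ +-cong (+-cong (zeroˡ _) (trans (Θ-cong (zeroʳ (a 0))) Θ-0)) (*-congˡ a-zero) ⟩
        0# + 0# + x * 1#                      ≈⟨ solve 1 (λ x → con 0 :+ con 0 :+ x :* con 1 := x) refl x ⟩
        x                                     ≈⟨ a-one ⟨
        a 1                                   ∎
      ⋆-fixed (suc n) = begin
        (a ⋆ b) (suc (suc n))                         ≈⟨ ⋆-rec (suc n) ⟩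
        Δ (x + x) (a ⋆ b) (suc n) + x * a (suc n)     ≈⟨ +-congʳ (Δ-cong (x + x) (suc n) (⋆-fixed n)) ⟩
        Δ (x + x) a (suc n) + x * a (suc n)           ≈⟨ a-suc (suc n) ⟨
        a (suc (suc n))                               ∎

      -- The term k = n + 1 of the binomial expansion drops out because G has no constant term in t,
      -- so the right side involves only earlier values of `a`.
      eulerian-convolution : ∀ n →
        a (suc n) ≈ ∑ (suc n) (λ k → (suc n C k) × (a k * b (suc n ∸ k)))
      eulerian-convolution n = begin
        a (suc n)                           ≈⟨ ⋆-fixed n ⟨
        (a ⋆ b) (suc n)                     ≈⟨ ⋆-binomial a b (suc n) ⟩
        ∑ (suc (suc n)) u                   ≈⟨ ∑-last (suc n) u ⟩
        ∑ (suc n) u + u (suc n)             ≈⟨ +-congˡ u-last ⟩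
        ∑ (suc n) u + 0#                    ≈⟨ +-identityʳ _ ⟩
        ∑ (suc n) u                         ∎
        where
        u : ℕ → Carrier
        u k = (suc n C k) × (a k * b (suc n ∸ k))
        u-last : u (suc n) ≈ 0#
        u-last = begin
          u (suc n)                          ≈⟨ ×-congˡ (nCn≡1 (suc n)) ⟩
          1 × (a (suc n) * b (n ∸ n))        ≈⟨ ×-homo-1 _ ⟩
          a (suc n) * b (n ∸ n)
            ≈⟨ *-congˡ (reflexive (≡.cong b (ℕ.n∸n≡0 n))) ⟩
          a (suc n) * 0#                     ≈⟨ zeroʳ _ ⟩
          0#                                 ∎

      -- Row m of `M` holds the coefficients of the convolution identity for `a (suc m)`. Since
      -- `a 0` is 1, its term k = 0 is the first column, and what remains is the recurrence of
      -- `det-hessenberg` with E j = `a (suc j)`.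
      det-eulerian : ∀ {M : ℕ → ℕ → Carrier} →
        IsHessenberg (λ i j → M i (suc j)) →
        (∀ i j → j ≤ i → M i j ≈ (suc i C j) × b (suc i ∸ j)) →
        ∀ n → a (suc n) ≈ detℕ (suc n) M
      det-eulerian {M} H below n = begin
        a (suc n)
          ≈⟨ det-hessenberg n (λ i → M i 0) (λ m → a (suc m)) H rec ⟨
        detℕ (suc n) ((λ i → M i 0) ◂ (λ i j → M i (suc j)))
          ≈⟨ det-cong (suc n) (λ i j → ((λ i → M i 0) ◂ (λ i j → M i (suc j))) (toℕ i) (toℕ j))
               (λ i j → M (toℕ i) (toℕ j))
               (λ { i Fin.zero → refl ; i (Fin.suc j) → refl }) ⟩
        detℕ (suc n) M ∎
        where
        rec : ∀ m → a (suc m) ≈ M m 0 + ∑ m (λ j → a (suc j) * M m (suc j))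
        rec m = begin
          a (suc m)
            ≈⟨ eulerian-convolution m ⟩
          ∑ (suc m) (λ k → (suc m C k) × (a k * b (suc m ∸ k)))
            ≈⟨ ∑-cong (suc m) (λ { k (s≤s k≤m) → trans
                 (sym (×-comm-* (suc m C k) (a k) (b (suc m ∸ k))))
                 (*-congˡ (sym (below m k k≤m))) }) ⟩
          a 0 * M m 0 + ∑ m (λ j → a (suc j) * M m (suc j))
            ≈⟨ +-congʳ (trans (*-congʳ a-zero) (*-identityˡ _)) ⟩
          M m 0 + ∑ m (λ j → a (suc j) * M m (suc j)) ∎

open import Defs

-- Integer polynomials as a commutative ring.

infixl 7 _⊛_
-- The Cauchy product, with the recursion of `_*_` on lists. On coefficient functions pointwise
-- equality is `_≈_`, so trailing zeros cause no trouble.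
_⊛_ : (ℕ → ℤ) → (ℕ → ℤ) → ℕ → ℤ
(f ⊛ g) zero    = f 0 ℤ.* g 0
(f ⊛ g) (suc k) = f 0 ℤ.* g (suc k) ℤ.+ ((λ i → f (suc i)) ⊛ g) k

module CauchyProduct where
  open +-*-Solver
  open ≡.≡-Reasoning

  ⊛-cong : ∀ {f f′ g g′} → f ≗ f′ → g ≗ g′ → f ⊛ g ≗ f′ ⊛ g′
  ⊛-cong p q zero    = ≡.cong₂ ℤ._*_ (p 0) (q 0)
  ⊛-cong p q (suc k) = ≡.cong₂ ℤ._+_
    (≡.cong₂ ℤ._*_ (p 0) (q (suc k))) (⊛-cong (λ i → p (suc i)) q k)

  ⊛-zeroˡ : ∀ g k → ((λ _ → 0ℤ) ⊛ g) k ≡ 0ℤ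
  ⊛-zeroˡ g zero    = ≡.refl
  ⊛-zeroˡ g (suc k) = ≡.trans (ℤ.+-identityˡ _) (⊛-zeroˡ g k)

  ⊛-distribʳ : ∀ h f g k →
    ((λ i → f i ℤ.+ g i) ⊛ h) k ≡ (f ⊛ h) k ℤ.+ (g ⊛ h) k
  ⊛-distribʳ h f g zero    = ℤ.*-distribʳ-+ (h 0) (f 0) (g 0)
  ⊛-distribʳ h f g (suc k) = ≡.trans
    (≡.cong (λ z → (f 0 ℤ.+ g 0) ℤ.* h (suc k) ℤ.+ z) (⊛-distribʳ h (λ i → f (suc i)) (λ i → g (suc i)) k))
    (solve 5 (λ a b c p q → (a :+ b) :* c :+ (p :+ q) := a :* c :+ p :+ (b :* c :+ q))
      ≡.refl (f 0) (g 0) (h (suc k)) _ _)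

  ⊛-scaleˡ : ∀ c f g k → ((λ i → c ℤ.* f i) ⊛ g) k ≡ c ℤ.* (f ⊛ g) k
  ⊛-scaleˡ c f g zero    = ℤ.*-assoc c (f 0) (g 0)
  ⊛-scaleˡ c f g (suc k) = ≡.trans
    (≡.cong (λ z → c ℤ.* f 0 ℤ.* g (suc k) ℤ.+ z) (⊛-scaleˡ c (λ i → f (suc i)) g k))
    (solve 4 (λ c a b p → c :* a :* b :+ c :* p := c :* (a :* b :+ p))
      ≡.refl c (f 0) (g (suc k)) _)

  -- The mirror image of the defining clause, peeling the right factor instead; commutativity needs
  -- both.
  ⊛-sucʳ : ∀ f g k →
    (f ⊛ g) (suc k) ≡ f (suc k) ℤ.* g 0 ℤ.+ (f ⊛ (λ i → g (suc i))) k
  ⊛-sucʳ f g zero    = ℤ.+-comm (f 0 ℤ.* g 1) (f 1 ℤ.* g 0)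
  ⊛-sucʳ f g (suc k) = ≡.trans
    (≡.cong (λ z → f 0 ℤ.* g (suc (suc k)) ℤ.+ z) (⊛-sucʳ (λ i → f (suc i)) g k))
    (solve 3 (λ a b c → a :+ (b :+ c) := b :+ (a :+ c)) ≡.refl
      (f 0 ℤ.* g (suc (suc k))) (f (suc (suc k)) ℤ.* g 0) _)

  ⊛-comm : ∀ f g k → (f ⊛ g) k ≡ (g ⊛ f) k
  ⊛-comm f g zero    = ℤ.*-comm (f 0) (g 0)
  ⊛-comm f g (suc k) = ≡.trans
    (≡.cong₂ ℤ._+_ (ℤ.*-comm (f 0) (g (suc k))) (⊛-comm (λ i → f (suc i)) g k))
    (≡.sym (⊛-sucʳ g f k))

  ⊛-assoc : ∀ f g h k → ((f ⊛ g) ⊛ h) k ≡ (f ⊛ (g ⊛ h)) k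
  ⊛-assoc f g h zero    = ℤ.*-assoc (f 0) (g 0) (h 0)
  ⊛-assoc f g h (suc k) = begin
    f 0 ℤ.* g 0 ℤ.* h (suc k) ℤ.+ ((λ i → f 0 ℤ.* Sg i ℤ.+ (Sf ⊛ g) i) ⊛ h) k
      ≡⟨ ≡.cong (λ z → f 0 ℤ.* g 0 ℤ.* h (suc k) ℤ.+ z) (begin
        ((λ i → f 0 ℤ.* Sg i ℤ.+ (Sf ⊛ g) i) ⊛ h) k
          ≡⟨ ⊛-distribʳ h _ (Sf ⊛ g) k ⟩
        ((λ i → f 0 ℤ.* Sg i) ⊛ h) k ℤ.+ ((Sf ⊛ g) ⊛ h) k
          ≡⟨ ≡.cong₂ ℤ._+_ (⊛-scaleˡ (f 0) Sg h k) (⊛-assoc Sf g h k) ⟩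
        f 0 ℤ.* (Sg ⊛ h) k ℤ.+ (Sf ⊛ (g ⊛ h)) k ∎) ⟩
    f 0 ℤ.* g 0 ℤ.* h (suc k) ℤ.+ (f 0 ℤ.* (Sg ⊛ h) k ℤ.+ (Sf ⊛ (g ⊛ h)) k)
      ≡⟨ solve 5 (λ a b c p q → a :* b :* c :+ (a :* p :+ q) := a :* (b :* c :+ p) :+ q)
           ≡.refl (f 0) (g 0) (h (suc k)) _ _ ⟩
    f 0 ℤ.* (g 0 ℤ.* h (suc k) ℤ.+ (Sg ⊛ h) k) ℤ.+ (Sf ⊛ (g ⊛ h)) k ∎
    where
    Sf Sg : ℕ → ℤ
    Sf i = f (suc i)
    Sg i = g (suc i)

  ⊛-identityˡ : ∀ g k → (coeff 𝟙 ⊛ g) k ≡ g k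
  ⊛-identityˡ g zero    = ℤ.*-identityˡ (g 0)
  ⊛-identityˡ g (suc k) =
    ≡.trans (≡.cong₂ ℤ._+_ (ℤ.*-identityˡ (g (suc k))) (⊛-zeroˡ g k)) (ℤ.+-identityʳ _)

  -- The operator x d/dx, for which the product rule can be proved by peeling
  -- off constant terms.
  euler : (ℕ → ℤ) → ℕ → ℤ
  euler f k = + k ℤ.* f k

  suc-* : ∀ k a → + suc k ℤ.* a ≡ + k ℤ.* a ℤ.+ a
  suc-* k a = ≡.trans (ℤ.suc-* (+ k) a) (ℤ.+-comm a _)

  euler-⊛ : ∀ f g k → euler (f ⊛ g) k ≡ (euler f ⊛ g) k ℤ.+ (f ⊛ euler g) k
  euler-⊛ f g zero    =
    solve 2 (λ a b → con 0ℤ :* (a :* b) := con 0ℤ :* a :* b :+ a :* (con 0ℤ :* b)) ≡.refl (f 0) (g 0)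
  euler-⊛ f g (suc k) = begin
    + suc k ℤ.* (f 0 ℤ.* g (suc k) ℤ.+ (Sf ⊛ g) k)
      ≡⟨ ≡.trans (ℤ.*-distribˡ-+ (+ suc k) (f 0 ℤ.* g (suc k)) _)
           (≡.cong (λ z → + suc k ℤ.* (f 0 ℤ.* g (suc k)) ℤ.+ z) (suc-* k ((Sf ⊛ g) k))) ⟩
    + suc k ℤ.* (f 0 ℤ.* g (suc k)) ℤ.+ (+ k ℤ.* (Sf ⊛ g) k ℤ.+ (Sf ⊛ g) k)
      ≡⟨ ≡.cong (λ z → + suc k ℤ.* (f 0 ℤ.* g (suc k)) ℤ.+ (z ℤ.+ (Sf ⊛ g) k)) (euler-⊛ Sf g k) ⟩
    + suc k ℤ.* (f 0 ℤ.* g (suc k)) ℤ.+ ((euler Sf ⊛ g) k ℤ.+ (Sf ⊛ euler g) k ℤ.+ (Sf ⊛ g) k)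
      -- The inserted zero is the constant term of `euler f`, and p + r is regrouped to become its
      -- tail.
      ≡⟨ solve 6 (λ n a b p q r → n :* (a :* b) :+ (p :+ q :+ r)
           := con 0ℤ :* a :* b :+ (p :+ r) :+ (a :* (n :* b) :+ q)) ≡.refl
           (+ suc k) (f 0) (g (suc k)) ((euler Sf ⊛ g) k) ((Sf ⊛ euler g) k) ((Sf ⊛ g) k) ⟩
    0ℤ ℤ.* f 0 ℤ.* g (suc k) ℤ.+ ((euler Sf ⊛ g) k ℤ.+ (Sf ⊛ g) k)
      ℤ.+ (f ⊛ euler g) (suc k)
      ≡⟨ ≡.cong (λ z → 0ℤ ℤ.* f 0 ℤ.* g (suc k) ℤ.+ z ℤ.+ (f ⊛ euler g) (suc k)) (begin
        (euler Sf ⊛ g) k ℤ.+ (Sf ⊛ g) k            ≡⟨ ⊛-distribʳ g (euler Sf) Sf k ⟨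
        ((λ i → euler Sf i ℤ.+ Sf i) ⊛ g) k        ≡⟨ ⊛-cong (λ i → suc-* i (Sf i)) (λ _ → ≡.refl) k ⟨
        ((λ i → euler f (suc i)) ⊛ g) k            ∎) ⟩
    (euler f ⊛ g) (suc k) ℤ.+ (f ⊛ euler g) (suc k) ∎
    where
    Sf : ℕ → ℤ
    Sf i = f (suc i)

open CauchyProduct

coeff-+ : ∀ p q k → coeff (p + q) k ≡ coeff p k ℤ.+ coeff q k
coeff-+ []      q       k       = ≡.sym (ℤ.+-identityˡ _)
coeff-+ (a ∷ p) []      k       = ≡.sym (ℤ.+-identityʳ _)
coeff-+ (a ∷ p) (b ∷ q) zero    = ≡.refl
coeff-+ (a ∷ p) (b ∷ q) (suc k) = coeff-+ p q k

coeff-· : ∀ c p k → coeff (c · p) k ≡ c ℤ.* coeff p k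
coeff-· c []      k       = ≡.sym (ℤ.*-zeroʳ c)
coeff-· c (a ∷ p) zero    = ≡.refl
coeff-· c (a ∷ p) (suc k) = coeff-· c p k

coeff-neg : ∀ p k → coeff (- p) k ≡ ℤ.- coeff p k
coeff-neg []      k       = ≡.refl
coeff-neg (a ∷ p) zero    = ≡.refl
coeff-neg (a ∷ p) (suc k) = coeff-neg p k

coeff-* : ∀ p q k → coeff (p * q) k ≡ (coeff p ⊛ coeff q) k
coeff-* []      q k       = ≡.sym (⊛-zeroˡ (coeff q) k)
coeff-* (a ∷ p) q zero    =
  ≡.trans (coeff-+ (a · q) _ 0) (≡.trans (ℤ.+-identityʳ _) (coeff-· a q 0))
coeff-* (a ∷ p) q (suc k) =
  ≡.trans (coeff-+ (a · q) _ (suc k)) (≡.cong₂ ℤ._+_ (coeff-· a q (suc k)) (coeff-* p q k))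

polyRing : CommutativeRing 0ℓ 0ℓ
polyRing = record
  { Carrier = Poly ; _≈_ = _≈_ ; _+_ = _+_ ; _*_ = _*_ ; -_ = -_ ; 0# = 𝟘 ; 1# = 𝟙
  ; isCommutativeRing = record
    { isRing = record
      { +-isAbelianGroup = record
        { isGroup = record
          { isMonoid = record
            { isSemigroup = record
              { isMagma = record
                { isEquivalence = record
                  { refl  = λ _ → ≡.refl
                  ; sym   = λ p k → ≡.sym (p k)
                  ; trans = λ p q k → ≡.trans (p k) (q k)
                  }
                ; ∙-cong = λ {p} {p′} {q} {q′} p≈ q≈ k → begin
                    coeff (p + q) k              ≡⟨ coeff-+ p q k ⟩
                    coeff p k ℤ.+ coeff q k      ≡⟨ ≡.cong₂ ℤ._+_ (p≈ k) (q≈ k) ⟩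
                    coeff p′ k ℤ.+ coeff q′ k    ≡⟨ coeff-+ p′ q′ k ⟨
                    coeff (p′ + q′) k            ∎
                }
              ; assoc = λ p q r k → begin
                  coeff (p + q + r) k                        ≡⟨ coeff-+ (p + q) r k ⟩
                  coeff (p + q) k ℤ.+ coeff r k              ≡⟨ ≡.cong (ℤ._+ coeff r k) (coeff-+ p q k) ⟩
                  coeff p k ℤ.+ coeff q k ℤ.+ coeff r k      ≡⟨ ℤ.+-assoc (coeff p k) (coeff q k) (coeff r k) ⟩
                  coeff p k ℤ.+ (coeff q k ℤ.+ coeff r k)    ≡⟨ ≡.cong (λ z → coeff p k ℤ.+ z) (coeff-+ q r k) ⟨
                  coeff p k ℤ.+ coeff (q + r) k              ≡⟨ coeff-+ p (q + r) k ⟨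
                  coeff (p + (q + r)) k                      ∎
              }
            ; identity = (λ _ _ → ≡.refl) , λ p k → ≡.trans (coeff-+ p 𝟘 k) (ℤ.+-identityʳ _)
            }
          ; inverse =
              (λ p k → ≡.trans (coeff-+ (- p) p k)
                (≡.trans (≡.cong (ℤ._+ coeff p k) (coeff-neg p k)) (ℤ.+-inverseˡ (coeff p k))))
            , (λ p k → ≡.trans (coeff-+ p (- p) k)
                (≡.trans (≡.cong (λ z → coeff p k ℤ.+ z) (coeff-neg p k)) (ℤ.+-inverseʳ (coeff p k))))
          ; ⁻¹-cong = λ {p} {q} p≈q k →
              ≡.trans (coeff-neg p k) (≡.trans (≡.cong ℤ.-_ (p≈q k)) (≡.sym (coeff-neg q k)))
          }
        ; comm = +-comm
        }
      ; *-cong = λ {p} {p′} {q} {q′} p≈ q≈ k → begin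
          coeff (p * q) k              ≡⟨ coeff-* p q k ⟩
          (coeff p ⊛ coeff q) k        ≡⟨ ⊛-cong p≈ q≈ k ⟩
          (coeff p′ ⊛ coeff q′) k      ≡⟨ coeff-* p′ q′ k ⟨
          coeff (p′ * q′) k            ∎
      ; *-assoc = λ p q r k → begin
          coeff (p * q * r) k                    ≡⟨ coeff-* (p * q) r k ⟩
          (coeff (p * q) ⊛ coeff r) k            ≡⟨ ⊛-cong (coeff-* p q) (λ _ → ≡.refl) k ⟩
          ((coeff p ⊛ coeff q) ⊛ coeff r) k      ≡⟨ ⊛-assoc (coeff p) (coeff q) (coeff r) k ⟩
          (coeff p ⊛ (coeff q ⊛ coeff r)) k      ≡⟨ ⊛-cong (λ _ → ≡.refl) (coeff-* q r) k ⟨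
          (coeff p ⊛ coeff (q * r)) k            ≡⟨ coeff-* p (q * r) k ⟨
          coeff (p * (q * r)) k                  ∎
      ; *-identity = *-identityˡ , λ p k → ≡.trans (*-comm p 𝟙 k) (*-identityˡ p k)
      ; distrib =
          (λ p q r k → begin
            coeff (p * (q + r)) k            ≡⟨ *-comm p (q + r) k ⟩
            coeff ((q + r) * p) k            ≡⟨ distribʳ p q r k ⟩
            coeff (q * p + r * p) k          ≡⟨ coeff-+ (q * p) (r * p) k ⟩
            coeff (q * p) k ℤ.+ coeff (r * p) k ≡⟨ ≡.cong₂ ℤ._+_ (*-comm q p k) (*-comm r p k) ⟩
            coeff (p * q) k ℤ.+ coeff (p * r) k ≡⟨ coeff-+ (p * q) (p * r) k ⟨
            coeff (p * q + p * r) k          ∎)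
        , distribʳ
      }
    ; *-comm = *-comm
    }
  }
  where
  open ≡.≡-Reasoning
  +-comm : ∀ p q → p + q ≈ q + p
  +-comm p q k = begin
    coeff (p + q) k            ≡⟨ coeff-+ p q k ⟩
    coeff p k ℤ.+ coeff q k    ≡⟨ ℤ.+-comm (coeff p k) (coeff q k) ⟩
    coeff q k ℤ.+ coeff p k    ≡⟨ coeff-+ q p k ⟨
    coeff (q + p) k            ∎
  *-comm : ∀ p q → p * q ≈ q * p
  *-comm p q k = begin
    coeff (p * q) k            ≡⟨ coeff-* p q k ⟩
    (coeff p ⊛ coeff q) k      ≡⟨ ⊛-comm (coeff p) (coeff q) k ⟩
    (coeff q ⊛ coeff p) k      ≡⟨ coeff-* q p k ⟨
    coeff (q * p) k            ∎
  *-identityˡ : ∀ p → 𝟙 * p ≈ p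
  *-identityˡ p k = ≡.trans (coeff-* 𝟙 p k) (⊛-identityˡ (coeff p) k)
  distribʳ : ∀ p q r → (q + r) * p ≈ q * p + r * p
  distribʳ p q r k = begin
    coeff ((q + r) * p) k                            ≡⟨ coeff-* (q + r) p k ⟩
    (coeff (q + r) ⊛ coeff p) k                      ≡⟨ ⊛-cong (coeff-+ q r) (λ _ → ≡.refl) k ⟩
    ((λ i → coeff q i ℤ.+ coeff r i) ⊛ coeff p) k    ≡⟨ ⊛-distribʳ (coeff p) (coeff q) (coeff r) k ⟩
    (coeff q ⊛ coeff p) k ℤ.+ (coeff r ⊛ coeff p) k  ≡⟨ ≡.cong₂ ℤ._+_ (coeff-* q p k) (coeff-* r p k) ⟨
    coeff (q * p) k ℤ.+ coeff (r * p) k              ≡⟨ coeff-+ (q * p) (r * p) k ⟨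
    coeff (q * p + r * p) k                          ∎

-- The operator x d/dx on polynomials.

coeff-derivativeFrom : ∀ m p k → coeff (derivativeFrom m p) k ≡ + (m ℕ.+ k) ℤ.* coeff p k
coeff-derivativeFrom m []      k       = ≡.sym (ℤ.*-zeroʳ (+ (m ℕ.+ k)))
coeff-derivativeFrom m (a ∷ p) zero    = ≡.cong (λ i → + i ℤ.* a) (≡.sym (ℕ.+-identityʳ m))
coeff-derivativeFrom m (a ∷ p) (suc k) = ≡.trans (coeff-derivativeFrom (suc m) p k)
  (≡.cong (λ i → + i ℤ.* coeff p k) (≡.sym (ℕ.+-suc m k)))

coeff-d/dx : ∀ p k → coeff (d/dx p) k ≡ + suc k ℤ.* coeff p (suc k)
coeff-d/dx []      k = ≡.sym (ℤ.*-zeroʳ (+ suc k))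
coeff-d/dx (a ∷ p) k = coeff-derivativeFrom 1 p k

-- Multiplication by x undoes the index shift of `d/dx`. The laws for `ϑ` thereby reduce to those
-- for weights on coefficients, the product rule to `euler-⊛`.
coeff-x*d/dx : ∀ p k → coeff (x * d/dx p) k ≡ euler (coeff p) k
coeff-x*d/dx p zero    = coeff-* x (d/dx p) 0
coeff-x*d/dx p (suc k) = begin
  coeff (x * d/dx p) (suc k)                     ≡⟨ coeff-* x (d/dx p) (suc k) ⟩
  0ℤ ℤ.* coeff (d/dx p) (suc k) ℤ.+ (coeff 𝟙 ⊛ coeff (d/dx p)) k
                                                 ≡⟨ ℤ.+-identityˡ _ ⟩
  (coeff 𝟙 ⊛ coeff (d/dx p)) k                   ≡⟨ ⊛-identityˡ _ k ⟩
  coeff (d/dx p) k                               ≡⟨ coeff-d/dx p k ⟩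
  + suc k ℤ.* coeff p (suc k)                    ∎
  where open ≡.≡-Reasoning

module Poly = CommutativeRing polyRing

ϑ : Poly → Poly
ϑ p = x * d/dx p

ϑ-cong : ∀ p q → p ≈ q → ϑ p ≈ ϑ q
ϑ-cong p q p≈q k = begin
  coeff (ϑ p) k      ≡⟨ coeff-x*d/dx p k ⟩
  + k ℤ.* coeff p k  ≡⟨ ≡.cong (+ k ℤ.*_) (p≈q k) ⟩
  + k ℤ.* coeff q k  ≡⟨ coeff-x*d/dx q k ⟨
  coeff (ϑ q) k      ∎
  where open ≡.≡-Reasoning

ϑ-+ : ∀ p q → ϑ (p + q) ≈ ϑ p + ϑ q
ϑ-+ p q k = begin
  coeff (ϑ (p + q)) k                    ≡⟨ coeff-x*d/dx (p + q) k ⟩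
  + k ℤ.* coeff (p + q) k                ≡⟨ ≡.cong (+ k ℤ.*_) (coeff-+ p q k) ⟩
  + k ℤ.* (coeff p k ℤ.+ coeff q k)      ≡⟨ ℤ.*-distribˡ-+ (+ k) (coeff p k) (coeff q k) ⟩
  + k ℤ.* coeff p k ℤ.+ + k ℤ.* coeff q k ≡⟨ ≡.cong₂ ℤ._+_ (coeff-x*d/dx p k) (coeff-x*d/dx q k) ⟨
  coeff (ϑ p) k ℤ.+ coeff (ϑ q) k        ≡⟨ coeff-+ (ϑ p) (ϑ q) k ⟨
  coeff (ϑ p + ϑ q) k                    ∎
  where open ≡.≡-Reasoning

ϑ-* : ∀ p q → ϑ (p * q) ≈ ϑ p * q + p * ϑ q
ϑ-* p q k = begin
  coeff (ϑ (p * q)) k                    ≡⟨ coeff-x*d/dx (p * q) k ⟩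
  + k ℤ.* coeff (p * q) k                ≡⟨ ≡.cong (+ k ℤ.*_) (coeff-* p q k) ⟩
  euler (coeff p ⊛ coeff q) k            ≡⟨ euler-⊛ (coeff p) (coeff q) k ⟩
  (euler (coeff p) ⊛ coeff q) k ℤ.+ (coeff p ⊛ euler (coeff q)) k
    ≡⟨ ≡.cong₂ ℤ._+_ (⊛-cong (coeff-x*d/dx p) (λ _ → ≡.refl) k) (⊛-cong (λ _ → ≡.refl) (coeff-x*d/dx q) k) ⟨
  (coeff (ϑ p) ⊛ coeff q) k ℤ.+ (coeff p ⊛ coeff (ϑ q)) k
    ≡⟨ ≡.cong₂ ℤ._+_ (coeff-* (ϑ p) q k) (coeff-* p (ϑ q) k) ⟨
  coeff (ϑ p * q) k ℤ.+ coeff (p * ϑ q) k ≡⟨ coeff-+ (ϑ p * q) (p * ϑ q) k ⟨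
  coeff (ϑ p * q + p * ϑ q) k            ∎
  where open ≡.≡-Reasoning

-- Both sides are closed lists, compared by computation; from index 3 on both have ended.
xyd-x : x * (𝟙 - x) * d/dx x + x * x ≈ x
xyd-x zero                      = ≡.refl
xyd-x (suc zero)                = ≡.refl
xyd-x (suc (suc zero))          = ≡.refl
xyd-x (suc (suc (suc _)))       = ≡.refl

-- The Eulerian recurrence and the matrix entries.

open SemiringMult Poly.semiring using (_×_)

-- Links integer scaling, used in the definitions, to the repeated addition in which the general
-- identity is phrased.
+·≈× : ∀ n p → + n · p ≈ n × p
+·≈× n p k = ≡.trans (coeff-· (+ n) p k) (≡.sym (coeff-× n))
  where
  coeff-× : ∀ m → coeff (m × p) k ≡ + m ℤ.* coeff p k
  coeff-× zero    = ≡.refl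
  coeff-× (suc m) = ≡.trans (coeff-+ p (m × p) k)
    (≡.trans (≡.cong (λ z → coeff p k ℤ.+ z) (coeff-× m)) (≡.sym (ℤ.suc-* (+ m) (coeff p k))))

secondOrderEulerian-rec : ∀ n → secondOrderEulerian (suc n) ≈
  suc (n ℕ.* 2) × (x * secondOrderEulerian n) + x * (𝟙 - x) * d/dx (secondOrderEulerian n)
secondOrderEulerian-rec n = Poly.+-congʳ {x * (𝟙 - x) * d/dx (secondOrderEulerian n)}
  {+ (2 ℕ.* suc n ∸ 1) · p} {suc (n ℕ.* 2) × p}
  -- After commuting the product, `suc n ℕ.* 2 ∸ 1` computes to `suc (n ℕ.* 2)` and the truncated
  -- subtraction is gone.
  (≡.subst (λ m → + (m ∸ 1) · p ≈ suc (n ℕ.* 2) × p) (ℕ.*-comm (suc n) 2) (+·≈× (suc (n ℕ.* 2)) p))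
  where
  p : Poly
  p = x * secondOrderEulerian n

module Eulerian = EulerianConvolution.Derivation polyRing x (𝟙 - x) d/dx ϑ-cong ϑ-+ ϑ-* xyd-x
open HessenbergDeterminant polyRing using (IsHessenberg)

entry-above : ∀ i j → i < j → entry (suc i) (suc (suc j)) ≈ 𝟘
entry-above i j i<j
  -- The three decisions compute to the Boolean tests of `entry`, once common successors are
  -- cancelled.
  rewrite dec-false (i ℕ.≟ suc j) (ℕ.<⇒≢ (ℕ.m<n⇒m<1+n i<j))
        | dec-false (suc j ℕ.<? i) (ℕ.<⇒≯ (ℕ.m<n⇒m<1+n i<j))
        | dec-false (j ℕ.≟ i) (ℕ.>⇒≢ i<j) = λ _ → ≡.refl

entry-superdiagonal : ∀ i → entry (suc i) (suc (suc i)) ≈ - 𝟙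
entry-superdiagonal i
  rewrite dec-false (i ℕ.≟ suc i) (ℕ.<⇒≢ (ℕ.n<1+n i))
        | dec-false (suc i ℕ.<? i) (ℕ.<⇒≯ (ℕ.n<1+n i))
        | dec-true (i ℕ.≟ i) ≡.refl = λ _ → ≡.refl

-- The exceptional diagonal factor x is the value of `Eulerian.∫` at 1, so the diagonal and the
-- entries below it share one formula.
entry-below : ∀ i j → j ≤ i →
  entry (suc i) (suc j) ≈ (suc i C j) × Eulerian.∫ secondOrderEulerian (suc i ∸ j)
entry-below i j j≤i = ≡.subst
  (λ p → entry (suc i) (suc j) ≈ (suc i C j) × p)
  (≡.cong (Eulerian.∫ secondOrderEulerian) (≡.sym (ℕ.+-∸-assoc 1 j≤i)))
  (cases (ℕ.m≤n⇒m<n∨m≡n j≤i))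
  where
  -- Positivity matters: at m = 0 the left side is 1 and the right side is x.
  ∫-suc : ∀ {m} → 0 < m → secondOrderEulerian m ≡ Eulerian.∫ secondOrderEulerian (suc m)
  ∫-suc (s≤s _) = ≡.refl
  cases : j < i ⊎ j ≡ i →
    entry (suc i) (suc j) ≈ (suc i C j) × Eulerian.∫ secondOrderEulerian (suc (i ∸ j))
  cases (inj₁ j<i)
    rewrite dec-false (i ℕ.≟ j) (ℕ.>⇒≢ j<i) | dec-true (j ℕ.<? i) j<i =
    ≡.subst (λ p → + (suc i C j) · secondOrderEulerian (i ∸ j) ≈ (suc i C j) × p)
      (∫-suc (ℕ.m<n⇒0<n∸m j<i)) (+·≈× (suc i C j) (secondOrderEulerian (i ∸ j)))
  cases (inj₂ ≡.refl)
    rewrite dec-true (i ℕ.≟ i) ≡.refl =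
    ≡.subst (λ m → + (suc i C i) · x ≈ (suc i C i) × Eulerian.∫ secondOrderEulerian (suc m))
      (≡.sym (ℕ.n∸n≡0 i)) (+·≈× (suc i C i) x)

entry-hessenberg : IsHessenberg (λ i j → entry (suc i) (suc (suc j)))
entry-hessenberg = record { diag = entry-superdiagonal ; above = entry-above }

theorem3p1 : (n : ℕ) → n ≥ 1 → secondOrderEulerian n ≈ det n (eulerianHessenberg n)
theorem3p1 (suc n) _ = Eulerian.det-eulerian secondOrderEulerian (λ _ → ≡.refl) secondOrderEulerian-rec
  {λ i j → entry (suc i) (suc j)} entry-hessenberg entry-below n
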